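{- Let $P(x)=a_nx^n+a_{n-1}x^{n-1}+\cdots+a_1x$ with integer coefficients $a_i\ge 0$, $a_n\ne 0$ and $\gcd(a_n,\dots,a_1)=1$. For integers $0<t<a$ define $m_{a,t}=\dfrac{P(a)}{\gcd(P(a),P(t))}$. Then \[ \mathsf{dens}(\mathcal{L}(a_n,\dots,a_1))=\lim_{N\to\infty}\frac{\displaystyle\sum_{a=1}^{N}\ \sum_{J\subseteq\{1,\dots,a-1\}}(-1)^{|J|}\left\lfloor\frac{N}{\operatorname{lcm}(m_{a,t}:t\in J)}\right\rfloor}{N^2}. \]
   Context: $\mathbb{N}=\{1,2,3,\dots\}$; the lcm over $J=\varnothing$ is $1$. The family $\mathcal{F}(a_n,\dots,a_1)$ is the set of curves $\{y=q(a_nx^n+\cdots+a_1x)\mid q\in\mathbb{Q}^+\}$. A point $(r,s)\in\mathbb{N}^2$ is $\mathcal{F}(a_n,\dots,a_1)$-visible if there is $q\in\mathbb{Q}^+$ with $s=qP(r)$ and no other point of $\mathbb{N}^2$ lies on the curve $y=qP(x)$ between the origin and $(r,s)$ (i.e. no $(x,y)\in\mathbb{N}^2$ with $0<x<r$ and $y=qP(x)$). $\mathcal{L}(a_n,\dots,a_1)$ denotes the set of all $\mathcal{F}(a_n,\dots,a_1)$-visible points in $\mathbb{N}^2$. For $S\subseteq\mathbb{N}^2$, $\mathsf{dens}(S)=\lim_{N\to\infty}|S\cap R_N|/N^2$, where $R_N=\{(a,b)\in\mathbb{Z}^2:1\le a,b\le N\}$. -}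

module Defs where

open import Data.Nat using (ℕ; zero; suc; _+_; _*_; _^_; _<_; _≤_)
open import Data.Nat.DivMod using (_/_)
open import Data.Nat.GCD using (gcd)
open import Data.Nat.LCM using (lcm)
open import Data.Fin using (Fin; toℕ)
open import Data.List using (List; []; _∷_; map; _++_; foldr; length; sum)
open import Data.List.Membership.Propositional using (_∈_)
open import Data.List.Relation.Unary.Unique.Propositional using (Unique)
open import Data.Integer as ℤ using (ℤ; +_; -_)
open import Data.Rational as ℚ using (ℚ; 0ℚ)
open import Data.Product using (_×_; ∃; Σ; _,_)
open import Relation.Binary.PropositionalEquality using (_≡_)
open import Relation.Nullary using (¬_)
open import Function.Bundles using (_⇔_)

-- Coefficients of P(x) = a_n x^n + ... + a_1 x, given as  a : Fin n → ℕ,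
-- where  a i  is the coefficient a_{i+1} of x^{i+1}.
sumFin : ∀ {n} → (Fin n → ℕ) → ℕ
sumFin {zero}  f = 0
sumFin {suc n} f = f Fin.zero + sumFin (λ i → f (Fin.suc i))

evalP : ∀ {n} → (Fin n → ℕ) → ℕ → ℕ
evalP a x = sumFin (λ i → a i * x ^ suc (toℕ i))

gcdAll : ∀ {n} → (Fin n → ℕ) → ℕ
gcdAll {zero}  a = 0
gcdAll {suc n} a = gcd (a Fin.zero) (gcdAll (λ i → a (Fin.suc i)))

-- natural-number division m / d  (floor); only ever used with d ≥ 1,
-- the d = 0 branch is a dummy value
divN : ℕ → ℕ → ℕ
divN m zero    = 0
divN m (suc d) = m / suc d

mP : ∀ {n} → (Fin n → ℕ) → ℕ → ℕ → ℕ
mP c a t = divN (evalP c a) (gcd (evalP c a) (evalP c t))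

range1 : ℕ → List ℕ
range1 zero    = []
range1 (suc k) = range1 k ++ (suc k ∷ [])

sublists : {A : Set} → List A → List (List A)
sublists []       = [] ∷ []
sublists (x ∷ xs) = sublists xs ++ map (x ∷_) (sublists xs)

lcmList : List ℕ → ℕ
lcmList = foldr lcm 1

sumℤ : List ℤ → ℤ
sumℤ = foldr ℤ._+_ (+ 0)

signℤ : ℕ → ℤ
signℤ zero    = + 1
signℤ (suc k) = - signℤ k

numer : ∀ {n} → (Fin n → ℕ) → ℕ → ℤ
numer c N =
  sumℤ (map (λ a → sumℤ (map (λ J → signℤ (length J) ℤ.* (+ divN N (lcmList (map (mP c a) J))))
                             (sublists (range1 (a Data.Nat.∸ 1)))))
            (range1 N))

ℕtoℚ : ℕ → ℚ
ℕtoℚ k = (+ k) ℚ./ 1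

Visible : ∀ {n} → (Fin n → ℕ) → ℕ × ℕ → Set
Visible c (r , s) =
  1 ≤ r × 1 ≤ s ×
  ∃ λ (q : ℚ) → (0ℚ ℚ.< q) × (ℕtoℚ s ≡ q ℚ.* ℕtoℚ (evalP c r)) ×
    (∀ x y → 1 ≤ x → x < r → 1 ≤ y → ¬ (ℕtoℚ y ≡ q ℚ.* ℕtoℚ (evalP c x)))

InBox : ℕ → ℕ × ℕ → Set
InBox N (x , y) = 1 ≤ x × x ≤ N × 1 ≤ y × y ≤ N

CountIs : (ℕ × ℕ → Set) → ℕ → ℕ → Set
CountIs S N k = Σ (List (ℕ × ℕ)) λ l →
  Unique l × length l ≡ k × (∀ p → (p ∈ l) ⇔ (S p × InBox N p))

TendsToZero : (ℕ → ℚ) → Set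
TendsToZero f = ∀ (ε : ℚ) → 0ℚ ℚ.< ε → ∃ λ N₀ → ∀ N → N₀ ≤ N → ℚ.∣ f N ∣ ℚ.< ε

-- ( |L ∩ R_N| - numer(N) ) / N²  , indexed by k with N = k+1
gapSeq : ∀ {n} → (Fin n → ℕ) → (ℕ → ℕ) → ℕ → ℚ
gapSeq c cnt k = ((+ cnt (suc k)) ℤ.- numer c (suc k)) ℚ./ (suc k * suc k)

-- A curve y = q P(x) through (r, s) has q = s / P(r), so it meets an integer point above
-- 0 < t < r iff P(r) ∣ s P(t), i.e. iff m_{r,t} = P(r) / gcd(P(r), P(t)) divides s.  Hence the
-- visible points of R_N in the column x = r are the s ≤ N divisible by none of the m_{r,t}, and
-- inclusion–exclusion counts them as Σ_J (-1)^|J| ⌊N / lcm(m_{r,t} : t ∈ J)⌋.  Summing over r,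
-- the numerator equals |L ∩ R_N| exactly, so the sequence of gaps is identically zero.
module Submission where

open import Defs
open import Data.Nat using (ℕ; suc)
open import Data.Fin using (Fin; fromℕ)
open import Relation.Binary.PropositionalEquality using (_≡_; _≢_)

open import Algebra.Bundles using (CommutativeMonoid)
open import Data.Fin using (toℕ)
open import Data.Integer as ℤ using (ℤ; +_)
import Data.Integer.Properties as ℤ
open import Data.List
  using (List; []; _∷_; _++_; [_]; map; length; filter; applyUpTo; cartesianProduct)
import Data.List.Properties as List
open import Data.List.Membership.Propositional using (_∈_)
import Data.List.Membership.Propositional.Properties as ∈
open import Data.List.Membership.Propositional.Properties.WithK using (unique∧set⇒bag)
open import Data.List.Relation.Binary.BagAndSetEquality using (∼bag⇒↭)
open import Data.List.Relation.Binary.Permutation.Propositional.Properties using (↭-length)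
open import Data.List.Relation.Unary.All as All using (All; []; _∷_; all?)
import Data.List.Relation.Unary.All.Properties as All
open import Data.List.Relation.Unary.Unique.Propositional using (Unique)
import Data.List.Relation.Unary.Unique.Propositional.Properties as Unique
open import Data.Nat as ℕ
  using (zero; _+_; _*_; _^_; _∸_; _≤_; _<_; z≤n; s≤s; NonZero; >-nonZero; >-nonZero⁻¹; ≢-nonZero)
open import Data.Nat.Coprimality using (coprime-/gcd; coprime-divisor)
open import Data.Nat.Divisibility
  using (_∣_; _∤_; _∣?_; divides; ∣-trans; ∣-reflexive; 1∣_; 0∣⇒≡0; n∣m*n; *-monoʳ-∣;
         n∣m⇒m%n≡0; m/n∣o⇒m∣o*n; m∣n*o⇒m/n∣o)
open import Data.Nat.DivMod
  using (_/_; _%_; m≡m%n+[m/n]*n; m%n<n; %-pred-≡0; /-congˡ; m*n/n≡m; m/n*n≡m; m<n⇒m/n≡0;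
         +-distrib-/-∣ʳ)
open import Data.Nat.GCD using (gcd; gcd[m,n]∣m; gcd[m,n]∣n; gcd[m,n]≢0)
open import Data.Nat.LCM using (lcm; m∣lcm[m,n]; n∣lcm[m,n]; lcm-least)
open import Data.Nat.ListAction using (sum)
import Data.Nat.Properties as ℕ
open import Data.Product using (∃; _×_; _,_)
open import Data.Rational as ℚ using (toℚᵘ; Positive)
import Data.Rational.Properties as ℚ
import Data.Rational.Unnormalised as ℚᵘ
import Data.Rational.Unnormalised.Properties as ℚᵘ
open import Data.Sum using (inj₁; inj₂)
open import Function.Base using (_∘_)
open import Function.Bundles using (_⇔_; mk⇔; Equivalence)
import Function.Properties.Equivalence as ⇔
open import Level using (0ℓ)
open import Relation.Binary.PropositionalEquality
  using (refl; sym; trans; cong; cong₂; subst; module ≡-Reasoning)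
open import Relation.Nullary using (¬_; yes; no; contradiction)
open import Relation.Nullary.Decidable using (_×-dec_; ¬?)
open import Relation.Unary using (Pred; Decidable; _∩_; ∁; _≐_)
open import Relation.Unary.Properties using (_∩?_; ∁?)

open import Algebra.Properties.AbelianGroup ℤ.+-0-abelianGroup using (xyx⁻¹≈y)
open import Algebra.Properties.CommutativeSemigroup
  (CommutativeMonoid.commutativeSemigroup ℚ.*-1-commutativeMonoid) using (xy∙z≈xz∙y)

lookup≤sumFin : ∀ {n} (f : Fin n → ℕ) i → f i ≤ sumFin f
lookup≤sumFin f Fin.zero    = ℕ.m≤m+n _ _
lookup≤sumFin f (Fin.suc i) = ℕ.≤-trans (lookup≤sumFin (f ∘ Fin.suc) i) (ℕ.m≤n+m _ _)

evalP-nonZero : ∀ {n} (a : Fin n → ℕ) i → a i ≢ 0 → ∀ {x} → 0 < x → NonZero (evalP a x)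
evalP-nonZero a i aᵢ≢0 {x} x>0 = >-nonZero (ℕ.≤-trans term>0 (lookup≤sumFin _ i))
  where
  term>0 : 0 < a i * x ^ suc (toℕ i)
  term>0 = >-nonZero⁻¹ _
    {{ℕ.m*n≢0 (a i) _ {{≢-nonZero aᵢ≢0}} {{ℕ.m^n≢0 x (suc (toℕ i)) {{>-nonZero x>0}}}}}}

toℚᵘ-ℕtoℚ : ∀ m → toℚᵘ (ℕtoℚ m) ℚᵘ.≃ ℚᵘ.mkℚᵘ (+ m) 0
toℚᵘ-ℕtoℚ m = ℚ.toℚᵘ-fromℚᵘ (ℚᵘ.mkℚᵘ (+ m) 0)

ℕtoℚ-homo-* : ∀ m n → ℕtoℚ (m * n) ≡ ℕtoℚ m ℚ.* ℕtoℚ n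
ℕtoℚ-homo-* m n = ℚ.toℚᵘ-injective (begin
  toℚᵘ (ℕtoℚ (m * n))                  ≈⟨ toℚᵘ-ℕtoℚ (m * n) ⟩
  ℚᵘ.mkℚᵘ (+ (m * n)) 0                ≈⟨ ℚᵘ.*≡* (cong (ℤ._* + 1) (ℤ.pos-* m n)) ⟩
  ℚᵘ.mkℚᵘ (+ m) 0 ℚᵘ.* ℚᵘ.mkℚᵘ (+ n) 0
    ≈⟨ ℚᵘ.*-cong (toℚᵘ-ℕtoℚ m) (toℚᵘ-ℕtoℚ n) ⟨
  toℚᵘ (ℕtoℚ m) ℚᵘ.* toℚᵘ (ℕtoℚ n)     ≈⟨ ℚ.toℚᵘ-homo-* (ℕtoℚ m) (ℕtoℚ n) ⟨
  toℚᵘ (ℕtoℚ m ℚ.* ℕtoℚ n)             ∎)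
  where open ℚᵘ.≃-Reasoning

ℕtoℚ-injective : ∀ {m n} → ℕtoℚ m ≡ ℕtoℚ n → m ≡ n
ℕtoℚ-injective {m} {n} eq
  with ℚᵘ.*≡* m*1≡n*1 ← ℚᵘ.≃-trans (ℚᵘ.≃-sym (toℚᵘ-ℕtoℚ m))
                                   (ℚᵘ.≃-trans (ℚ.toℚᵘ-cong eq) (toℚᵘ-ℕtoℚ n))
  = ℤ.+-injective (trans (sym (ℤ.*-identityʳ (+ m))) (trans m*1≡n*1 (ℤ.*-identityʳ (+ n))))

ℕtoℚ-pos : ∀ n → .{{_ : NonZero n}} → Positive (ℕtoℚ n)
ℕtoℚ-pos (suc n) = ℚ.normalize-pos (suc n) 1

*-cancelʳ-≡-pos : ∀ {p q} r → .{{_ : Positive r}} → p ℚ.* r ≡ q ℚ.* r → p ≡ q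
*-cancelʳ-≡-pos r pr≡qr =
  ℚ.≤-antisym (ℚ.*-cancelʳ-≤-pos r (ℚ.≤-reflexive pr≡qr))
              (ℚ.*-cancelʳ-≤-pos r (ℚ.≤-reflexive (sym pr≡qr)))

onCurve⇔y*u≡s*v : ∀ q s u v y → .{{_ : NonZero u}} → ℕtoℚ s ≡ q ℚ.* ℕtoℚ u →
                  ℕtoℚ y ≡ q ℚ.* ℕtoℚ v ⇔ y * u ≡ s * v
onCurve⇔y*u≡s*v q s u v y s-on = mk⇔ to from
  where
  open ≡-Reasoning
  instance _ = ℕtoℚ-pos u
  to : ℕtoℚ y ≡ q ℚ.* ℕtoℚ v → y * u ≡ s * v
  to y-on = ℕtoℚ-injective (begin
    ℕtoℚ (y * u)             ≡⟨ ℕtoℚ-homo-* y u ⟩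
    ℕtoℚ y ℚ.* ℕtoℚ u        ≡⟨ cong (ℚ._* ℕtoℚ u) y-on ⟩
    q ℚ.* ℕtoℚ v ℚ.* ℕtoℚ u  ≡⟨ xy∙z≈xz∙y q (ℕtoℚ v) (ℕtoℚ u) ⟩
    q ℚ.* ℕtoℚ u ℚ.* ℕtoℚ v  ≡⟨ cong (ℚ._* ℕtoℚ v) s-on ⟨
    ℕtoℚ s ℚ.* ℕtoℚ v        ≡⟨ ℕtoℚ-homo-* s v ⟨
    ℕtoℚ (s * v)             ∎)
  from : y * u ≡ s * v → ℕtoℚ y ≡ q ℚ.* ℕtoℚ v
  from y*u≡s*v = *-cancelʳ-≡-pos (ℕtoℚ u) (begin
    ℕtoℚ y ℚ.* ℕtoℚ u        ≡⟨ ℕtoℚ-homo-* y u ⟨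
    ℕtoℚ (y * u)             ≡⟨ cong ℕtoℚ y*u≡s*v ⟩
    ℕtoℚ (s * v)             ≡⟨ ℕtoℚ-homo-* s v ⟩
    ℕtoℚ s ℚ.* ℕtoℚ v        ≡⟨ cong (ℚ._* ℕtoℚ v) s-on ⟩
    q ℚ.* ℕtoℚ u ℚ.* ℕtoℚ v  ≡⟨ xy∙z≈xz∙y q (ℕtoℚ u) (ℕtoℚ v) ⟩
    q ℚ.* ℕtoℚ v ℚ.* ℕtoℚ u  ∎)

curveThrough : ∀ s u → .{{_ : NonZero s}} → .{{_ : NonZero u}} →
               ∃ λ q → Positive q × ℕtoℚ s ≡ q ℚ.* ℕtoℚ u
curveThrough s u = q , ℚ.pos*pos⇒pos (ℕtoℚ s) (ℚ.1/ ℕtoℚ u) {{ℚ.1/pos⇒pos (ℕtoℚ u)}} , (begin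
  ℕtoℚ s                               ≡⟨ ℚ.*-identityʳ (ℕtoℚ s) ⟨
  ℕtoℚ s ℚ.* ℚ.1ℚ                      ≡⟨ cong (ℕtoℚ s ℚ.*_) (ℚ.*-inverseˡ (ℕtoℚ u)) ⟨
  ℕtoℚ s ℚ.* (ℚ.1/ ℕtoℚ u ℚ.* ℕtoℚ u)  ≡⟨ ℚ.*-assoc (ℕtoℚ s) (ℚ.1/ ℕtoℚ u) (ℕtoℚ u) ⟨
  q ℚ.* ℕtoℚ u                         ∎)
  where
  open ≡-Reasoning
  instance
    _ = ℕtoℚ-pos s
    _ = ℕtoℚ-pos u
    _ = ℚ.pos⇒nonZero (ℕtoℚ u)
  q = ℕtoℚ s ℚ.* ℚ.1/ ℕtoℚ u

m∣o*n⇔m/gcd[m,n]∣o : ∀ m n o → .{{_ : NonZero (gcd m n)}} → m ∣ o * n ⇔ m / gcd m n ∣ o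
m∣o*n⇔m/gcd[m,n]∣o m n o = mk⇔ to from
  where
  open ≡-Reasoning
  g = gcd m n
  n/g*o*g≡o*n : n / g * o * g ≡ o * n
  n/g*o*g≡o*n = begin
    n / g * o * g    ≡⟨ ℕ.*-assoc (n / g) o g ⟩
    n / g * (o * g)  ≡⟨ cong (n / g *_) (ℕ.*-comm o g) ⟩
    n / g * (g * o)  ≡⟨ ℕ.*-assoc (n / g) g o ⟨
    n / g * g * o    ≡⟨ cong (_* o) (m/n*n≡m (gcd[m,n]∣n m n)) ⟩
    n * o            ≡⟨ ℕ.*-comm n o ⟩
    o * n            ∎
  to : m ∣ o * n → m / g ∣ o
  to m∣o*n = coprime-divisor (coprime-/gcd m n)
    (m∣n*o⇒m/n∣o (gcd[m,n]∣m m n) (∣-trans m∣o*n (∣-reflexive (sym n/g*o*g≡o*n))))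
  from : m / g ∣ o → m ∣ o * n
  from m/g∣o = ∣-trans (m/n∣o⇒m∣o*n (gcd[m,n]∣m m n) m/g∣o) (*-monoʳ-∣ o (gcd[m,n]∣n m n))

divN≡/ : ∀ m d → .{{_ : NonZero d}} → divN m d ≡ m / d
divN≡/ m (suc d) = refl

module Visibility {n} (a : Fin n → ℕ) (P-nonZero : ∀ {x} → 0 < x → NonZero (evalP a x)) where

  private
    P = evalP a

  P[r]∣s*P[t]⇔mP∣s : ∀ {r} t s → 0 < r → P r ∣ s * P t ⇔ mP a r t ∣ s
  P[r]∣s*P[t]⇔mP∣s {r} t s r>0 = subst (λ m → P r ∣ s * P t ⇔ m ∣ s)
    (sym (divN≡/ (P r) (gcd (P r) (P t)) {{gcd≢0}}))
    (m∣o*n⇔m/gcd[m,n]∣o (P r) (P t) s {{gcd≢0}})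
    where
    gcd≢0 : NonZero (gcd (P r) (P t))
    gcd≢0 = ≢-nonZero (gcd[m,n]≢0 (P r) (P t) (inj₁ (ℕ.≢-nonZero⁻¹ (P r) {{P-nonZero r>0}})))

  Unobstructed : ℕ → ℕ → Set
  Unobstructed r s = ∀ t → 0 < t → t < r → mP a r t ∤ s

  visible⇒unobstructed : ∀ {r s} → Visible a (r , s) → Unobstructed r s
  visible⇒unobstructed {r} {s} (r>0 , s>0 , q , _ , s-on , clear) t t>0 t<r mP∣s
    with divides y s*P[t]≡y*P[r] ← Equivalence.from (P[r]∣s*P[t]⇔mP∣s t s r>0) mP∣s
    = clear t y t>0 t<r y>0
        (Equivalence.from (onCurve⇔y*u≡s*v q s (P r) (P t) y {{P-nonZero r>0}} s-on) (sym s*P[t]≡y*P[r]))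
    where
    y>0 : 0 < y
    y>0 = >-nonZero⁻¹ y {{ℕ.m*n≢0⇒m≢0 y {{subst NonZero s*P[t]≡y*P[r]
            (ℕ.m*n≢0 s (P t) {{>-nonZero s>0}} {{P-nonZero t>0}})}}}}

  unobstructed⇒visible : ∀ {r s} → 0 < r → 0 < s → Unobstructed r s → Visible a (r , s)
  unobstructed⇒visible {r} {s} r>0 s>0 free
    with q , q>0 , s-on ← curveThrough s (P r) {{>-nonZero s>0}} {{P-nonZero r>0}}
    = r>0 , s>0 , q , ℚ.positive⁻¹ q {{q>0}} , s-on , blocked
    where
    blocked : ∀ x y → 0 < x → x < r → 0 < y → ¬ ℕtoℚ y ≡ q ℚ.* ℕtoℚ (P x)
    blocked x y x>0 x<r _ y-on = free x x>0 x<r (Equivalence.to (P[r]∣s*P[t]⇔mP∣s x s r>0)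
      (divides y (sym (Equivalence.to (onCurve⇔y*u≡s*v q s (P r) (P x) y {{P-nonZero r>0}} s-on) y-on))))

range1≡applyUpTo : ∀ N → range1 N ≡ applyUpTo suc N
range1≡applyUpTo zero    = refl
range1≡applyUpTo (suc N) = trans (cong (_++ [ suc N ]) (range1≡applyUpTo N)) (List.applyUpTo-∷ʳ suc N)

∈-range1⇔ : ∀ {N t} → t ∈ range1 N ⇔ (0 < t × t ≤ N)
∈-range1⇔ {N} rewrite range1≡applyUpTo N = mk⇔ to from
  where
  to : ∀ {t} → t ∈ applyUpTo suc N → 0 < t × t ≤ N
  to t∈ with _ , i<N , refl ← ∈.∈-applyUpTo⁻ suc t∈ = s≤s z≤n , i<N
  from : ∀ {t} → 0 < t × t ≤ N → t ∈ applyUpTo suc N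
  from (s≤s z≤n , t≤N) = ∈.∈-applyUpTo⁺ suc t≤N

range1-unique : ∀ N → Unique (range1 N)
range1-unique N rewrite range1≡applyUpTo N =
  Unique.applyUpTo⁺₁ suc N (λ i<j _ → ℕ.<⇒≢ i<j ∘ ℕ.suc-injective)

suc-/-∣ : ∀ m d .{{_ : NonZero d}} → d ∣ suc m → suc m / d ≡ suc (m / d)
suc-/-∣ m d@(suc d-1) d∣1+m = trans (/-congˡ 1+m≡[1+m/d]*d) (m*n/n≡m (suc (m / d)) d)
  where
  open ≡-Reasoning
  1+m≡[1+m/d]*d : suc m ≡ suc (m / d) * d
  1+m≡[1+m/d]*d = begin
    suc m                    ≡⟨ cong suc (m≡m%n+[m/n]*n m d) ⟩
    suc (m % d + m / d * d)  ≡⟨ cong (λ r → suc (r + m / d * d)) (%-pred-≡0 (n∣m⇒m%n≡0 (suc m) d d∣1+m)) ⟩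
    d + m / d * d            ∎

suc-/-∤ : ∀ m d .{{_ : NonZero d}} → d ∤ suc m → suc m / d ≡ m / d
suc-/-∤ m d d∤1+m with ℕ.m≤n⇒m<n∨m≡n (m%n<n m d)
... | inj₂ 1+m%d≡d = contradiction (divides (suc (m / d)) 1+m≡[1+m/d]*d) d∤1+m
  where
  1+m≡[1+m/d]*d : suc m ≡ suc (m / d) * d
  1+m≡[1+m/d]*d = trans (cong suc (m≡m%n+[m/n]*n m d)) (cong (_+ m / d * d) 1+m%d≡d)
... | inj₁ 1+m%d<d = begin
  suc m / d                        ≡⟨ /-congˡ (cong suc (m≡m%n+[m/n]*n m d)) ⟩
  (suc (m % d) + m / d * d) / d    ≡⟨ +-distrib-/-∣ʳ (suc (m % d)) (n∣m*n (m / d)) ⟩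
  suc (m % d) / d + m / d * d / d  ≡⟨ cong₂ _+_ (m<n⇒m/n≡0 1+m%d<d) (m*n/n≡m (m / d) d) ⟩
  m / d                            ∎
  where open ≡-Reasoning

divN-suc : ∀ m d → divN (suc m) d ≡ divN m d + length (filter (d ∣?_) [ suc m ])
divN-suc m d with d ∣? suc m
... | yes d∣1+m = divN-suc-∣ d d∣1+m
  where
  divN-suc-∣ : ∀ d → d ∣ suc m → divN (suc m) d ≡ divN m d + 1
  divN-suc-∣ zero      0∣1+m = contradiction (0∣⇒≡0 0∣1+m) λ ()
  divN-suc-∣ (suc d-1) d∣1+m = trans (suc-/-∣ m (suc d-1) d∣1+m) (ℕ.+-comm 1 _)
... | no  d∤1+m = divN-suc-∤ d d∤1+m
  where
  divN-suc-∤ : ∀ d → d ∤ suc m → divN (suc m) d ≡ divN m d + 0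
  divN-suc-∤ zero      _     = refl
  divN-suc-∤ (suc d-1) d∤1+m = trans (suc-/-∤ m (suc d-1) d∤1+m) (sym (ℕ.+-identityʳ _))

length-filter-∣-range1 : ∀ d N → length (filter (d ∣?_) (range1 N)) ≡ divN N d
length-filter-∣-range1 zero      zero    = refl
length-filter-∣-range1 (suc d-1) zero    = refl
length-filter-∣-range1 d         (suc N) = begin
  length (filter (d ∣?_) (range1 N ++ [ suc N ]))
    ≡⟨ cong length (List.filter-++ (d ∣?_) (range1 N) [ suc N ]) ⟩
  length (filter (d ∣?_) (range1 N) ++ filter (d ∣?_) [ suc N ])
    ≡⟨ List.length-++ (filter (d ∣?_) (range1 N)) ⟩
  length (filter (d ∣?_) (range1 N)) + length (filter (d ∣?_) [ suc N ])
    ≡⟨ cong (_+ length (filter (d ∣?_) [ suc N ])) (length-filter-∣-range1 d N) ⟩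
  divN N d + length (filter (d ∣?_) [ suc N ])
    ≡⟨ divN-suc N d ⟨
  divN (suc N) d ∎
  where open ≡-Reasoning

length-filter-split : ∀ {a p q} {A : Set a} {P : Pred A p} {Q : Pred A q}
  (P? : Decidable P) (Q? : Decidable Q) xs →
  length (filter P? xs) ≡ length (filter (P? ∩? Q?) xs) + length (filter (P? ∩? ∁? Q?) xs)
length-filter-split P? Q? [] = refl
length-filter-split P? Q? (x ∷ xs) with P? x | Q? x
... | yes _ | yes _ = cong suc (length-filter-split P? Q? xs)
... | yes _ | no  _ = trans (cong suc (length-filter-split P? Q? xs)) (sym (ℕ.+-suc _ _))
... | no  _ | _     = length-filter-split P? Q? xs

length-filter-map : ∀ {a b p} {A : Set a} {B : Set b} {P : Pred B p} (P? : Decidable P) (f : A → B) xs →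
  length (filter P? (map f xs)) ≡ length (filter (P? ∘ f) xs)
length-filter-map P? f []       = refl
length-filter-map P? f (x ∷ xs) with P? (f x)
... | yes _ = cong suc (length-filter-map P? f xs)
... | no  _ = length-filter-map P? f xs

length-filter-cartesianProduct : ∀ {a b p} {A : Set a} {B : Set b} {P : Pred (A × B) p}
  (P? : Decidable P) xs ys →
  length (filter P? (cartesianProduct xs ys)) ≡ sum (map (λ x → length (filter (λ y → P? (x , y)) ys)) xs)
length-filter-cartesianProduct P? []       ys = refl
length-filter-cartesianProduct P? (x ∷ xs) ys = begin
  length (filter P? (map (x ,_) ys ++ cartesianProduct xs ys))
    ≡⟨ cong length (List.filter-++ P? (map (x ,_) ys) (cartesianProduct xs ys)) ⟩
  length (filter P? (map (x ,_) ys) ++ filter P? (cartesianProduct xs ys))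
    ≡⟨ List.length-++ (filter P? (map (x ,_) ys)) ⟩
  length (filter P? (map (x ,_) ys)) + length (filter P? (cartesianProduct xs ys))
    ≡⟨ cong₂ _+_ (length-filter-map P? (x ,_) ys) (length-filter-cartesianProduct P? xs ys) ⟩
  sum (map (λ x → length (filter (λ y → P? (x , y)) ys)) (x ∷ xs)) ∎
  where open ≡-Reasoning

unique-length : ∀ {a} {A : Set a} {xs ys : List A} → Unique xs → Unique ys →
  (∀ {x} → x ∈ xs ⇔ x ∈ ys) → length xs ≡ length ys
unique-length xs! ys! xs⇔ys = ↭-length (∼bag⇒↭ (unique∧set⇒bag xs! ys! xs⇔ys))

sublists-map : ∀ {A B : Set} (f : A → B) xs → sublists (map f xs) ≡ map (map f) (sublists xs)
sublists-map f []       = refl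
sublists-map f (x ∷ xs) = begin
  S′ ++ map (f x ∷_) S′                          ≡⟨ cong (λ T → T ++ map (f x ∷_) T) (sublists-map f xs) ⟩
  map (map f) S ++ map (f x ∷_) (map (map f) S)  ≡⟨ cong (map (map f) S ++_) (List.map-∘ S) ⟨
  map (map f) S ++ map (map f ∘ (x ∷_)) S        ≡⟨ cong (map (map f) S ++_) (List.map-∘ S) ⟩
  map (map f) S ++ map (map f) (map (x ∷_) S)    ≡⟨ List.map-++ (map f) S (map (x ∷_) S) ⟨
  map (map f) (S ++ map (x ∷_) S)                ∎
  where
  open ≡-Reasoning
  S  = sublists xs
  S′ = sublists (map f xs)

sumℤ-++ : ∀ xs ys → sumℤ (xs ++ ys) ≡ sumℤ xs ℤ.+ sumℤ ys
sumℤ-++ []       ys = sym (ℤ.+-identityˡ (sumℤ ys))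
sumℤ-++ (x ∷ xs) ys = trans (cong (λ i → x ℤ.+ i) (sumℤ-++ xs ys)) (sym (ℤ.+-assoc x (sumℤ xs) (sumℤ ys)))

sumℤ-map-neg : ∀ xs → sumℤ (map ℤ.-_ xs) ≡ ℤ.- sumℤ xs
sumℤ-map-neg []       = refl
sumℤ-map-neg (x ∷ xs) =
  trans (cong (λ i → ℤ.- x ℤ.+ i) (sumℤ-map-neg xs)) (sym (ℤ.neg-distrib-+ x (sumℤ xs)))

sumℤ-map-+ : ∀ {A : Set} (f : A → ℕ) xs → sumℤ (map (λ x → + f x) xs) ≡ + sum (map f xs)
sumℤ-map-+ f []       = refl
sumℤ-map-+ f (x ∷ xs) =
  trans (cong (λ i → + f x ℤ.+ i) (sumℤ-map-+ f xs)) (sym (ℤ.pos-+ (f x) (sum (map f xs))))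

lcmList∣⇔ : ∀ ds {s} → lcmList ds ∣ s ⇔ All (_∣ s) ds
lcmList∣⇔ []       {s} = mk⇔ (λ _ → []) (λ _ → 1∣ s)
lcmList∣⇔ (d ∷ ds) {s} = mk⇔
  (λ l∣s → ∣-trans (m∣lcm[m,n] d _) l∣s
         ∷ Equivalence.to (lcmList∣⇔ ds) (∣-trans (n∣lcm[m,n] d _) l∣s))
  (λ { (d∣s ∷ ds∣s) → lcm-least d∣s (Equivalence.from (lcmList∣⇔ ds) ds∣s) })

-- The required divisors ds are kept as a list rather than folded into their lcm, so that
-- moving a modulus from ms to ds is list reassociation and needs no lcm algebra.
Sieved : List ℕ → List ℕ → Pred ℕ 0ℓ
Sieved ds ms s = All (_∣ s) ds × All (_∤ s) ms

sieved? : ∀ ds ms → Decidable (Sieved ds ms)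
sieved? ds ms s = all? (_∣? s) ds ×-dec all? (λ m → ¬? (m ∣? s)) ms

Sieved-[] : ∀ ds → Sieved ds [] ≐ (lcmList ds ∣_)
Sieved-[] ds = (λ (ds∣s , _) → Equivalence.from (lcmList∣⇔ ds) ds∣s)
             , (λ l∣s → Equivalence.to (lcmList∣⇔ ds) l∣s , [])

Sieved-∣ : ∀ ds m ms → Sieved ds ms ∩ (m ∣_) ≐ Sieved (ds ++ [ m ]) ms
Sieved-∣ ds m ms = (λ ((ds∣s , ms∤s) , m∣s) → All.++⁺ ds∣s (m∣s ∷ []) , ms∤s)
                 , (λ (dsm∣s , ms∤s) → (All.++⁻ˡ ds dsm∣s , ms∤s) , All.head (All.++⁻ʳ ds dsm∣s))

Sieved-∤ : ∀ ds m ms → Sieved ds ms ∩ ∁ (m ∣_) ≐ Sieved ds (m ∷ ms)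
Sieved-∤ ds m ms = (λ ((ds∣s , ms∤s) , m∤s) → ds∣s , m∤s ∷ ms∤s)
                 , (λ (ds∣s , m∷ms∤s) → (ds∣s , All.tail m∷ms∤s) , All.head m∷ms∤s)

length-filter-sieved-∷ : ∀ ds m ms xs → length (filter (sieved? ds ms) xs) ≡
  length (filter (sieved? (ds ++ [ m ]) ms) xs) + length (filter (sieved? ds (m ∷ ms)) xs)
length-filter-sieved-∷ ds m ms xs = trans (length-filter-split (sieved? ds ms) (m ∣?_) xs) (cong₂ _+_
  (cong length (List.filter-≐ (sieved? ds ms ∩? (m ∣?_)) (sieved? (ds ++ [ m ]) ms) (Sieved-∣ ds m ms) xs))
  (cong length (List.filter-≐ (sieved? ds ms ∩? ∁? (m ∣?_)) (sieved? ds (m ∷ ms)) (Sieved-∤ ds m ms) xs)))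

inclusionExclusionTerm : ℕ → List ℕ → List ℕ → ℤ
inclusionExclusionTerm N ds J = signℤ (length J) ℤ.* + divN N (lcmList (ds ++ J))

inclusionExclusion : ℕ → List ℕ → List ℕ → ℤ
inclusionExclusion N ds ms = sumℤ (map (inclusionExclusionTerm N ds) (sublists ms))

inclusionExclusionTerm-∷ : ∀ N ds m J →
  inclusionExclusionTerm N ds (m ∷ J) ≡ ℤ.- inclusionExclusionTerm N (ds ++ [ m ]) J
inclusionExclusionTerm-∷ N ds m J = trans
  (cong (λ ns → ℤ.- signℤ (length J) ℤ.* + divN N (lcmList ns)) (sym (List.++-assoc ds [ m ] J)))
  (sym (ℤ.neg-distribˡ-* (signℤ (length J)) _))

inclusionExclusion-∷ : ∀ N ds m ms →
  inclusionExclusion N ds (m ∷ ms) ≡ inclusionExclusion N ds ms ℤ.- inclusionExclusion N (ds ++ [ m ]) ms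
inclusionExclusion-∷ N ds m ms = begin
  sumℤ (map T (S ++ map (m ∷_) S))                ≡⟨ cong sumℤ (List.map-++ T S (map (m ∷_) S)) ⟩
  sumℤ (map T S ++ map T (map (m ∷_) S))          ≡⟨ cong (λ xs → sumℤ (map T S ++ xs)) terms-with-m ⟩
  sumℤ (map T S ++ map ℤ.-_ (map T′ S))           ≡⟨ sumℤ-++ (map T S) (map ℤ.-_ (map T′ S)) ⟩
  sumℤ (map T S) ℤ.+ sumℤ (map ℤ.-_ (map T′ S))   ≡⟨ cong (λ i → sumℤ (map T S) ℤ.+ i) (sumℤ-map-neg (map T′ S)) ⟩
  sumℤ (map T S) ℤ.- sumℤ (map T′ S)              ∎
  where
  open ≡-Reasoning
  T  = inclusionExclusionTerm N ds
  T′ = inclusionExclusionTerm N (ds ++ [ m ])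
  S  = sublists ms
  terms-with-m : map T (map (m ∷_) S) ≡ map ℤ.-_ (map T′ S)
  terms-with-m = begin
    map T (map (m ∷_) S)  ≡⟨ List.map-∘ S ⟨
    map (T ∘ (m ∷_)) S    ≡⟨ List.map-cong (inclusionExclusionTerm-∷ N ds m) S ⟩
    map (ℤ.-_ ∘ T′) S     ≡⟨ List.map-∘ S ⟩
    map ℤ.-_ (map T′ S)   ∎

length-filter-sieved : ∀ N ds ms → + length (filter (sieved? ds ms) (range1 N)) ≡ inclusionExclusion N ds ms
length-filter-sieved N ds [] = begin
  + length (filter (sieved? ds []) (range1 N))
    ≡⟨ cong (λ xs → + length xs) (List.filter-≐ (sieved? ds []) (lcmList ds ∣?_) (Sieved-[] ds) (range1 N)) ⟩
  + length (filter (lcmList ds ∣?_) (range1 N))  ≡⟨ cong +_ (length-filter-∣-range1 (lcmList ds) N) ⟩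
  + divN N (lcmList ds)                          ≡⟨ cong (λ ns → + divN N (lcmList ns)) (List.++-identityʳ ds) ⟨
  + divN N (lcmList (ds ++ []))                  ≡⟨ ℤ.*-identityˡ _ ⟨
  inclusionExclusionTerm N ds []                 ≡⟨ ℤ.+-identityʳ _ ⟨
  inclusionExclusion N ds []                     ∎
  where open ≡-Reasoning
length-filter-sieved N ds (m ∷ ms) = begin
  + c                  ≡⟨ xyx⁻¹≈y (+ b) (+ c) ⟨
  + b ℤ.+ + c ℤ.- + b  ≡⟨ cong (ℤ._- + b) (ℤ.pos-+ b c) ⟨
  + (b + c) ℤ.- + b    ≡⟨ cong (λ n → + n ℤ.- + b) (length-filter-sieved-∷ ds m ms (range1 N)) ⟨
  + a ℤ.- + b          ≡⟨ cong₂ ℤ._-_ (length-filter-sieved N ds ms) (length-filter-sieved N (ds ++ [ m ]) ms) ⟩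
  inclusionExclusion N ds ms ℤ.- inclusionExclusion N (ds ++ [ m ]) ms ≡⟨ inclusionExclusion-∷ N ds m ms ⟨
  inclusionExclusion N ds (m ∷ ms) ∎
  where
  open ≡-Reasoning
  a = length (filter (sieved? ds ms) (range1 N))
  b = length (filter (sieved? (ds ++ [ m ]) ms) (range1 N))
  c = length (filter (sieved? ds (m ∷ ms)) (range1 N))

module Counting {n} (a : Fin n → ℕ) (P-nonZero : ∀ {x} → 0 < x → NonZero (evalP a x)) where

  open Visibility a P-nonZero

  obstructions : ℕ → List ℕ
  obstructions r = map (mP a r) (range1 (r ∸ 1))

  sieved⇔unobstructed : ∀ {r s} → 0 < r → Sieved [] (obstructions r) s ⇔ Unobstructed r s
  sieved⇔unobstructed {suc r-1} _ = mk⇔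
    (λ (_ , free) t t>0 t<r →
      All.lookup (All.map⁻ free) (Equivalence.from ∈-range1⇔ (t>0 , ℕ.≤-pred t<r)))
    (λ free → [] , All.map⁺ (All.tabulate λ t∈ →
      let t>0 , t≤r-1 = Equivalence.to ∈-range1⇔ t∈ in free _ t>0 (s≤s t≤r-1)))

  visible? : Decidable (λ ((r , s) : ℕ × ℕ) → Sieved [] (obstructions r) s)
  visible? (r , s) = sieved? [] (obstructions r) s

  visiblePoints : ℕ → List (ℕ × ℕ)
  visiblePoints N = filter visible? (cartesianProduct (range1 N) (range1 N))

  ∈-visiblePoints⇔ : ∀ {N p} → p ∈ visiblePoints N ⇔ (Visible a p × InBox N p)
  ∈-visiblePoints⇔ {N} {r , s} = mk⇔ to from
    where
    to : (r , s) ∈ visiblePoints N → Visible a (r , s) × InBox N (r , s)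
    to p∈ with p∈R² , sieved ← ∈.∈-filter⁻ visible? p∈
          with r∈R , s∈R ← ∈.∈-cartesianProduct⁻ (range1 N) (range1 N) p∈R²
          with r>0 , r≤N ← Equivalence.to ∈-range1⇔ r∈R
             | s>0 , s≤N ← Equivalence.to ∈-range1⇔ s∈R
      = unobstructed⇒visible r>0 s>0 (Equivalence.to (sieved⇔unobstructed r>0) sieved) , r>0 , r≤N , s>0 , s≤N
    from : Visible a (r , s) × InBox N (r , s) → (r , s) ∈ visiblePoints N
    from (vis , r>0 , r≤N , s>0 , s≤N) = ∈.∈-filter⁺ visible?
      (∈.∈-cartesianProduct⁺ (Equivalence.from ∈-range1⇔ (r>0 , r≤N))
                             (Equivalence.from ∈-range1⇔ (s>0 , s≤N)))
      (Equivalence.from (sieved⇔unobstructed r>0) (visible⇒unobstructed vis))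

  visiblePoints-unique : ∀ N → Unique (visiblePoints N)
  visiblePoints-unique N = Unique.filter⁺ visible? (Unique.cartesianProduct⁺ (range1-unique N) (range1-unique N))

  countIs⇒≡length : ∀ {N c} → CountIs (Visible a) N c → c ≡ length (visiblePoints N)
  countIs⇒≡length {N} (l , l! , refl , l⇔) =
    unique-length l! (visiblePoints-unique N) (λ {p} → ⇔.trans (l⇔ p) (⇔.sym (∈-visiblePoints⇔ {N})))

  numer≡length : ∀ N → numer a N ≡ + length (visiblePoints N)
  numer≡length N = begin
    numer a N                                 ≡⟨ cong sumℤ (List.map-cong column≡ (range1 N)) ⟩
    sumℤ (map (λ r → + column r) (range1 N))  ≡⟨ sumℤ-map-+ column (range1 N) ⟩
    + sum (map column (range1 N))
      ≡⟨ cong +_ (length-filter-cartesianProduct visible? (range1 N) (range1 N)) ⟨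
    + length (visiblePoints N)                ∎
    where
    open ≡-Reasoning
    column : ℕ → ℕ
    column r = length (filter (sieved? [] (obstructions r)) (range1 N))
    column≡ : ∀ r → sumℤ (map (λ J → signℤ (length J) ℤ.* + divN N (lcmList (map (mP a r) J)))
                               (sublists (range1 (r ∸ 1)))) ≡ + column r
    column≡ r = begin
      sumℤ (map (λ J → signℤ (length J) ℤ.* + divN N (lcmList (map (mP a r) J))) S)
        ≡⟨ cong sumℤ (List.map-cong (λ J → cong (λ k → signℤ k ℤ.* + divN N (lcmList (map (mP a r) J)))
                                                (sym (List.length-map (mP a r) J))) S) ⟩
      sumℤ (map (T ∘ map (mP a r)) S)           ≡⟨ cong sumℤ (List.map-∘ S) ⟩
      sumℤ (map T (map (map (mP a r)) S))       ≡⟨ cong (sumℤ ∘ map T) (sublists-map (mP a r) (range1 (r ∸ 1))) ⟨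
      inclusionExclusion N [] (obstructions r)  ≡⟨ length-filter-sieved N [] (obstructions r) ⟨
      + column r                                ∎
      where
      S = sublists (range1 (r ∸ 1))
      T = inclusionExclusionTerm N []

≡0⇒TendsToZero : ∀ {f} → (∀ k → f k ≡ ℚ.0ℚ) → TendsToZero f
≡0⇒TendsToZero f≡0 ε ε>0 = 0 , λ k _ → subst (λ q → ℚ.∣ q ∣ ℚ.< ε) (sym (f≡0 k)) ε>0

-- The count is exact.
lemma3p9 : (k : ℕ) (a : Fin (suc k) → ℕ) → a (fromℕ k) ≢ 0 → gcdAll a ≡ 1 →
    (cnt : ℕ → ℕ) → (∀ N → CountIs (Visible a) N (cnt N)) →
    TendsToZero (gapSeq a cnt)
lemma3p9 k a aₖ≢0 _ cnt counts = ≡0⇒TendsToZero gap≡0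
  where
  open Counting a (evalP-nonZero a (fromℕ k) aₖ≢0)
  cnt≡numer : ∀ N → + cnt N ≡ numer a N
  cnt≡numer N = trans (cong +_ (countIs⇒≡length (counts N))) (sym (numer≡length N))
  gap≡0 : ∀ k → gapSeq a cnt k ≡ ℚ.0ℚ
  gap≡0 k = trans (cong (ℚ._/ (suc k * suc k)) (ℤ.i≡j⇒i-j≡0 (cnt≡numer (suc k))))
                  (ℚ.0/n≡0 (suc k * suc k))
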